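{- Let $C$, $C'$, $P$ and $Q$ be $n\times n$ matrices. Assume that (i) $PCQ\le PC'Q$ (entrywise); (ii) $C'$ has an eigenvector $Qu$ for $\lambda'$, for some nonnegative column vector $u=(u_1,\ldots,u_n)^T$ and $\lambda'\in\mathbb{R}$; (iii) $C$ has a left eigenvector $v^TP$ for $\lambda$, for some nonnegative row vector $v^T=(v_1,\ldots,v_n)$ and $\lambda\in\mathbb{R}$; and (iv) $v^TPQu>0$. Then $\lambda\le\lambda'$. Moreover, $\lambda=\lambda'$ if and only if $(PC'Q)_{ij}=(PCQ)_{ij}$ for all $1\le i,j\le n$ with $v_i\ne0$ and $u_j\ne0$.
   Context: All matrices and vectors are real. "Eigenvector" means right eigenvector (so $C'Qu=\lambda'Qu$, $Qu\neq 0$), and a left eigenvector $w^T$ of $C$ for $\lambda$ satisfies $w^TC=\lambda w^T$, $w\ne0$. -}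

module Defs where

open import Algebra.Bundles.Raw using (RawMonoid)
open import Algebra.Definitions.RawMonoid using () renaming (sum to ∑)
open import Data.Fin.Base using (Fin)
open import Data.Nat.Base as ℕ using (ℕ)
import Data.Nat.Properties as ℕ
open import Data.Product.Base using (∃; _×_; _,_)
open import Data.Rational as ℚ using (ℚ; 0ℚ; 1ℚ; ½; ∣_∣; 1/_; positive; nonNegative)
import Data.Rational.Properties as ℚ
open import Data.Rational.Solver using (module +-*-Solver)
open import Data.Vec.Functional using (Vector)
open import Level using (0ℓ)
open import Relation.Binary.PropositionalEquality using (_≡_; refl; sym; trans; cong; subst)
open import Relation.Nullary.Negation using (¬_)

-- The real numbers are the Cauchy sequences of rationals, considered up to
-- the setoid equality _≈_ below (the difference is a null sequence).

IsCauchy : (ℕ → ℚ) → Set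
IsCauchy x = ∀ ε → 0ℚ ℚ.< ε →
  ∃ λ N → ∀ m n → N ℕ.≤ m → N ℕ.≤ n → ∣ x m ℚ.- x n ∣ ℚ.< ε

record ℝ : Set where
  constructor mkℝ
  field
    seq    : ℕ → ℚ
    cauchy : IsCauchy seq

open ℝ public

infix 4 _≈_ _≤_ _<_

_≈_ : ℝ → ℝ → Set
x ≈ y = ∀ ε → 0ℚ ℚ.< ε →
  ∃ λ N → ∀ n → N ℕ.≤ n → ∣ seq x n ℚ.- seq y n ∣ ℚ.< ε

_<_ : ℝ → ℝ → Set
x < y = ∃ λ ε → 0ℚ ℚ.< ε ×
  ∃ λ N → ∀ n → N ℕ.≤ n → seq x n ℚ.+ ε ℚ.< seq y n

-- The usual constructive order: classically it is "x < y or x ≈ y", which is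
-- not a usable definition without a decision between the two cases.

_≤_ : ℝ → ℝ → Set
x ≤ y = ∀ ε → 0ℚ ℚ.< ε →
  ∃ λ N → ∀ n → N ℕ.≤ n → seq x n ℚ.< seq y n ℚ.+ ε

open +-*-Solver

+-diff : ∀ a b c d → (a ℚ.+ b) ℚ.- (c ℚ.+ d) ≡ (a ℚ.- c) ℚ.+ (b ℚ.- d)
+-diff = solve 4 (λ a b c d → (a :+ b) :- (c :+ d) := (a :- c) :+ (b :- d)) refl

*-diff : ∀ a b c d → a ℚ.* b ℚ.- c ℚ.* d ≡ a ℚ.* (b ℚ.- d) ℚ.+ d ℚ.* (a ℚ.- c)
*-diff = solve 4 (λ a b c d → a :* b :- c :* d := a :* (b :- d) :+ d :* (a :- c)) refl

shift : ∀ a b → a ≡ (a ℚ.- b) ℚ.+ b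
shift = solve 2 (λ a b → a := (a :- b) :+ b) refl

halve : ∀ ε → ½ ℚ.* ε ℚ.+ ½ ℚ.* ε ≡ ε
halve ε = trans (sym (ℚ.*-distribʳ-+ ε ½ ½)) (ℚ.*-identityˡ ε)

0<½ε : ∀ {ε} → 0ℚ ℚ.< ε → 0ℚ ℚ.< ½ ℚ.* ε
0<½ε {ε} 0<ε = subst (ℚ._< ½ ℚ.* ε) (ℚ.*-zeroʳ ½) (ℚ.*-monoʳ-<-pos ½ 0<ε)

0<1 : 0ℚ ℚ.< 1ℚ
0<1 = ℚ.positive⁻¹ 1ℚ

*-bound : ∀ a b {A δ} → ∣ a ∣ ℚ.≤ A → 0ℚ ℚ.< A → ∣ b ∣ ℚ.< δ → ∣ a ℚ.* b ∣ ℚ.< A ℚ.* δ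
*-bound a b {A} {δ} a≤A 0<A b<δ = begin-strict
  ∣ a ℚ.* b ∣        ≡⟨ ℚ.∣p*q∣≡∣p∣*∣q∣ a b ⟩
  ∣ a ∣ ℚ.* ∣ b ∣    ≤⟨ ℚ.*-monoʳ-≤-nonNeg ∣ b ∣ {{nonNegative (ℚ.0≤∣p∣ b)}} a≤A ⟩
  A ℚ.* ∣ b ∣        <⟨ ℚ.*-monoʳ-<-pos A {{positive 0<A}} b<δ ⟩
  A ℚ.* δ            ∎
  where open ℚ.≤-Reasoning

divide : ∀ K {ε} .{{_ : ℚ.Positive K}} → 0ℚ ℚ.< ε → ∃ λ δ → 0ℚ ℚ.< δ × K ℚ.* δ ≡ ε
divide K {ε} 0<ε = K⁻¹ ℚ.* ε
  , subst (ℚ._< K⁻¹ ℚ.* ε) (ℚ.*-zeroʳ K⁻¹) (ℚ.*-monoʳ-<-pos K⁻¹ {{ℚ.1/pos⇒pos K}} 0<ε)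
  , trans (sym (ℚ.*-assoc K K⁻¹ ε))
      (trans (cong (ℚ._* ε) (ℚ.*-inverseʳ K {{ℚ.pos⇒nonZero K}})) (ℚ.*-identityˡ ε))
  where
  K⁻¹ : ℚ
  K⁻¹ = (1/ K) {{ℚ.pos⇒nonZero K}}

bounded : ∀ {x} → IsCauchy x →
  ∃ λ B → 0ℚ ℚ.< B × ∃ λ N → ∀ n → N ℕ.≤ n → ∣ x n ∣ ℚ.≤ B
bounded {x} cx with cx 1ℚ 0<1
... | N , h = B , ℚ.+-mono-<-≤ 0<1 (ℚ.0≤∣p∣ (x N)) , N , λ n N≤n → begin
    ∣ x n ∣                         ≡⟨ cong ∣_∣ (shift (x n) (x N)) ⟩
    ∣ (x n ℚ.- x N) ℚ.+ x N ∣       ≤⟨ ℚ.∣p+q∣≤∣p∣+∣q∣ (x n ℚ.- x N) (x N) ⟩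
    ∣ x n ℚ.- x N ∣ ℚ.+ ∣ x N ∣     ≤⟨ ℚ.+-monoˡ-≤ ∣ x N ∣ (ℚ.<⇒≤ (h n N N≤n ℕ.≤-refl)) ⟩
    B                               ∎
  where
  open ℚ.≤-Reasoning
  B : ℚ
  B = 1ℚ ℚ.+ ∣ x N ∣

const-cauchy : ∀ q → IsCauchy (λ _ → q)
const-cauchy q ε 0<ε =
  0 , λ _ _ _ _ → subst (ℚ._< ε) (sym (cong ∣_∣ (ℚ.+-inverseʳ q))) 0<ε

+-cauchy : ∀ {x y} → IsCauchy x → IsCauchy y → IsCauchy (λ n → x n ℚ.+ y n)
+-cauchy {x} {y} cx cy ε 0<ε
  with cx (½ ℚ.* ε) (0<½ε 0<ε) | cy (½ ℚ.* ε) (0<½ε 0<ε)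
... | M , f | N , g = M ℕ.⊔ N , λ m n M⊔N≤m M⊔N≤n → begin-strict
    ∣ (x m ℚ.+ y m) ℚ.- (x n ℚ.+ y n) ∣       ≡⟨ cong ∣_∣ (+-diff (x m) (y m) (x n) (y n)) ⟩
    ∣ (x m ℚ.- x n) ℚ.+ (y m ℚ.- y n) ∣       ≤⟨ ℚ.∣p+q∣≤∣p∣+∣q∣ (x m ℚ.- x n) (y m ℚ.- y n) ⟩
    ∣ x m ℚ.- x n ∣ ℚ.+ ∣ y m ℚ.- y n ∣       <⟨ ℚ.+-mono-<
                                                   (f m n (ℕ.m⊔n≤o⇒m≤o M N M⊔N≤m) (ℕ.m⊔n≤o⇒m≤o M N M⊔N≤n))
                                                   (g m n (ℕ.m⊔n≤o⇒n≤o M N M⊔N≤m) (ℕ.m⊔n≤o⇒n≤o M N M⊔N≤n)) ⟩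
    ½ ℚ.* ε ℚ.+ ½ ℚ.* ε                       ≡⟨ halve ε ⟩
    ε                                         ∎
  where open ℚ.≤-Reasoning

*-cauchy : ∀ {x y} → IsCauchy x → IsCauchy y → IsCauchy (λ n → x n ℚ.* y n)
*-cauchy {x} {y} cx cy ε 0<ε =
  let A , 0<A , K , x≤A = bounded cx
      B , 0<B , L , y≤B = bounded cy
      δ , 0<δ , [A+B]δ≡ε = divide (A ℚ.+ B) {{positive (ℚ.+-mono-< 0<A 0<B)}} 0<ε
      M , f = cx δ 0<δ
      N , g = cy δ 0<δ
      open ℚ.≤-Reasoning
  in (K ℕ.⊔ L) ℕ.⊔ (M ℕ.⊔ N) , λ m n hm hn →
    let KL≤m = ℕ.m⊔n≤o⇒m≤o (K ℕ.⊔ L) (M ℕ.⊔ N) hm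
        KL≤n = ℕ.m⊔n≤o⇒m≤o (K ℕ.⊔ L) (M ℕ.⊔ N) hn
        MN≤m = ℕ.m⊔n≤o⇒n≤o (K ℕ.⊔ L) (M ℕ.⊔ N) hm
        MN≤n = ℕ.m⊔n≤o⇒n≤o (K ℕ.⊔ L) (M ℕ.⊔ N) hn
    in begin-strict
      ∣ x m ℚ.* y m ℚ.- x n ℚ.* y n ∣
        ≡⟨ cong ∣_∣ (*-diff (x m) (y m) (x n) (y n)) ⟩
      ∣ x m ℚ.* (y m ℚ.- y n) ℚ.+ y n ℚ.* (x m ℚ.- x n) ∣
        ≤⟨ ℚ.∣p+q∣≤∣p∣+∣q∣ (x m ℚ.* (y m ℚ.- y n)) (y n ℚ.* (x m ℚ.- x n)) ⟩
      ∣ x m ℚ.* (y m ℚ.- y n) ∣ ℚ.+ ∣ y n ℚ.* (x m ℚ.- x n) ∣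
        <⟨ ℚ.+-mono-<
             (*-bound (x m) (y m ℚ.- y n) (x≤A m (ℕ.m⊔n≤o⇒m≤o K L KL≤m)) 0<A
               (g m n (ℕ.m⊔n≤o⇒n≤o M N MN≤m) (ℕ.m⊔n≤o⇒n≤o M N MN≤n)))
             (*-bound (y n) (x m ℚ.- x n) (y≤B n (ℕ.m⊔n≤o⇒n≤o K L KL≤n)) 0<B
               (f m n (ℕ.m⊔n≤o⇒m≤o M N MN≤m) (ℕ.m⊔n≤o⇒m≤o M N MN≤n))) ⟩
      A ℚ.* δ ℚ.+ B ℚ.* δ
        ≡⟨ ℚ.*-distribʳ-+ δ A B ⟨
      (A ℚ.+ B) ℚ.* δ
        ≡⟨ [A+B]δ≡ε ⟩
      ε ∎

infixl 6 _+_
infixl 7 _*_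

0ℝ : ℝ
0ℝ = mkℝ (λ _ → 0ℚ) (const-cauchy 0ℚ)

_+_ : ℝ → ℝ → ℝ
x + y = mkℝ (λ n → seq x n ℚ.+ seq y n) (+-cauchy {seq x} {seq y} (cauchy x) (cauchy y))

_*_ : ℝ → ℝ → ℝ
x * y = mkℝ (λ n → seq x n ℚ.* seq y n) (*-cauchy {seq x} {seq y} (cauchy x) (cauchy y))

+-rawMonoid : RawMonoid 0ℓ 0ℓ
+-rawMonoid = record { Carrier = ℝ ; _≈_ = _≈_ ; _∙_ = _+_ ; ε = 0ℝ }

sum : ∀ {n} → Vector ℝ n → ℝ
sum = ∑ +-rawMonoid

Matrix : ℕ → Set
Matrix n = Fin n → Fin n → ℝ

infixl 7 _·_ _∗_ _∗ᵥ_ _ᵥ∗_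

_·_ : ∀ {n} → Vector ℝ n → Vector ℝ n → ℝ
v · u = sum (λ i → v i * u i)

_∗_ : ∀ {n} → Matrix n → Matrix n → Matrix n
(A ∗ B) i j = sum (λ k → A i k * B k j)

_∗ᵥ_ : ∀ {n} → Matrix n → Vector ℝ n → Vector ℝ n
(A ∗ᵥ u) i = sum (λ j → A i j * u j)

_ᵥ∗_ : ∀ {n} → Vector ℝ n → Matrix n → Vector ℝ n
(v ᵥ∗ A) j = sum (λ i → v i * A i j)

NonNegative : ∀ {n} → Vector ℝ n → Set
NonNegative u = ∀ i → 0ℝ ≤ u i

NonZero : ∀ {n} → Vector ℝ n → Set
NonZero u = ¬ (∀ i → u i ≈ 0ℝ)

IsEigenvector : ∀ {n} → Matrix n → ℝ → Vector ℝ n → Set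
IsEigenvector A μ x = NonZero x × (∀ i → (A ∗ᵥ x) i ≈ μ * x i)

IsLeftEigenvector : ∀ {n} → Matrix n → ℝ → Vector ℝ n → Set
IsLeftEigenvector A μ w = NonZero w × (∀ j → (w ᵥ∗ A) j ≈ μ * w j)

{-# OPTIONS --safe #-}
module Submission where

-- Put w = vP, x = Qu and s = w · x > 0. Then μ s = vᵀ(PCQ)u and μ′ s = vᵀ(PC′Q)u,
-- and the terms of the first double sum are at most those of the second; so
-- μ ≤ μ′, with equality exactly when the two sums agree term by term.
--
-- Constructively, the order on ℝ is not decidable, but ≤ is the negation of the
-- reversed strict order, hence ≤ and ≈ are stable under double negation. This
-- is what makes the case distinctions on v i ≈ 0ℝ and u j ≈ 0ℝ legitimate.

open import Defs
open import Algebra.Bundles using (CommutativeSemiring)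
open import Algebra.Structures.Biased using (IsCommutativeSemiringˡ)
import Algebra.Properties.Semiring.Sum as SemiringSum
open import Data.Fin.Base using (Fin; zero; suc)
open import Data.Nat.Base as ℕ using (ℕ; zero; suc)
import Data.Nat.Properties as ℕ
open import Data.Product.Base using (∃; _×_; _,_)
open import Data.Rational as ℚ using (ℚ; 0ℚ; 1ℚ; ½; ∣_∣; positive)
import Data.Rational.Properties as ℚ
open import Data.Rational.Solver using (module +-*-Solver)
open import Data.Sum.Base using (_⊎_; inj₁; inj₂; [_,_]′)
open import Data.Vec.Functional using (Vector)
open import Function.Base using (_∘_)
open import Function.Bundles using (_⇔_; mk⇔)
open import Level using (0ℓ)
import Relation.Binary.Reasoning.Setoid as SetoidReasoning
open import Relation.Binary.PropositionalEquality using (_≡_; refl; sym; trans; cong; subst)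
open import Relation.Binary.Structures using (IsEquivalence)
open import Relation.Nullary.Decidable using (yes; no)
open import Relation.Nullary.Negation using (¬_; contradiction)

open +-*-Solver

-- Eventual properties and rational estimates.

Eventually : (ℕ → Set) → Set
Eventually P = ∃ λ N → ∀ n → N ℕ.≤ n → P n

eventually-map : {P Q : ℕ → Set} → (∀ n → P n → Q n) → Eventually P → Eventually Q
eventually-map f (N , p) = N , λ n N≤n → f n (p n N≤n)

eventually-zip : {P Q R : ℕ → Set} → (∀ n → P n → Q n → R n) →
  Eventually P → Eventually Q → Eventually R
eventually-zip f (M , p) (N , q) = M ℕ.⊔ N , λ n M⊔N≤n →
  f n (p n (ℕ.m⊔n≤o⇒m≤o M N M⊔N≤n)) (q n (ℕ.m⊔n≤o⇒n≤o M N M⊔N≤n))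

p≤∣p∣ : ∀ p → p ℚ.≤ ∣ p ∣
p≤∣p∣ p with ℚ.≤-total 0ℚ p
... | inj₁ 0≤p = ℚ.≤-reflexive (sym (ℚ.0≤p⇒∣p∣≡p 0≤p))
... | inj₂ p≤0 = ℚ.≤-trans p≤0 (ℚ.0≤∣p∣ p)

∣p-q∣≡∣q-p∣ : ∀ p q → ∣ p ℚ.- q ∣ ≡ ∣ q ℚ.- p ∣
∣p-q∣≡∣q-p∣ p q = trans
  (cong ∣_∣ (solve 2 (λ p q → p :- q := :- (q :- p)) refl p q))
  (ℚ.∣-p∣≡∣p∣ (q ℚ.- p))

p-q<r⇒p<q+r : ∀ {p q r} → p ℚ.- q ℚ.< r → p ℚ.< q ℚ.+ r
p-q<r⇒p<q+r {p} {q} {r} p-q<r = begin-strict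
  p                  ≡⟨ solve 2 (λ p q → p := q :+ (p :- q)) refl p q ⟩
  q ℚ.+ (p ℚ.- q)    <⟨ ℚ.+-monoʳ-< q p-q<r ⟩
  q ℚ.+ r            ∎
  where open ℚ.≤-Reasoning

p<q+r⇒p-q<r : ∀ {p q r} → p ℚ.< q ℚ.+ r → p ℚ.- q ℚ.< r
p<q+r⇒p-q<r {p} {q} {r} p<q+r = begin-strict
  p ℚ.- q            <⟨ ℚ.+-monoˡ-< (ℚ.- q) p<q+r ⟩
  (q ℚ.+ r) ℚ.- q    ≡⟨ solve 2 (λ q r → (q :+ r) :- q := r) refl q r ⟩
  r                  ∎
  where open ℚ.≤-Reasoning

∣p-q∣<r : ∀ {p q r} → p ℚ.< q ℚ.+ r → q ℚ.< p ℚ.+ r → ∣ p ℚ.- q ∣ ℚ.< r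
∣p-q∣<r {p} {q} {r} p<q+r q<p+r with ℚ.∣p∣≡p∨∣p∣≡-p (p ℚ.- q)
... | inj₁ eq = subst (ℚ._< r) (sym eq) (p<q+r⇒p-q<r p<q+r)
... | inj₂ eq = subst (ℚ._< r)
  (sym (trans eq (solve 2 (λ p q → :- (p :- q) := q :- p) refl p q)))
  (p<q+r⇒p-q<r q<p+r)

-- Equality and order of real numbers.

-- _≈_, _≤_ and _<_ unfold to statements about seq, from which the real numbers
-- cannot be inferred; this is why implicit arguments are given explicitly below.
≈⇒≤ : ∀ {x y} → x ≈ y → x ≤ y
≈⇒≤ {x} {y} x≈y ε 0<ε = eventually-map
  (λ n → p-q<r⇒p<q+r ∘ ℚ.≤-<-trans (p≤∣p∣ (seq x n ℚ.- seq y n))) (x≈y ε 0<ε)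

≤-antisym : ∀ {x y} → x ≤ y → y ≤ x → x ≈ y
≤-antisym x≤y y≤x ε 0<ε = eventually-zip (λ _ → ∣p-q∣<r) (x≤y ε 0<ε) (y≤x ε 0<ε)

≈-sym : ∀ {x y} → x ≈ y → y ≈ x
≈-sym {x} {y} x≈y ε 0<ε = eventually-map
  (λ n → subst (ℚ._< ε) (∣p-q∣≡∣q-p∣ (seq x n) (seq y n))) (x≈y ε 0<ε)

≤-trans : ∀ {x y z} → x ≤ y → y ≤ z → x ≤ z
≤-trans {x} {y} {z} x≤y y≤z ε 0<ε = eventually-zip (λ n p q → begin-strict
    seq x n                                <⟨ p ⟩
    seq y n ℚ.+ ½ ℚ.* ε                    <⟨ ℚ.+-monoˡ-< (½ ℚ.* ε) q ⟩
    (seq z n ℚ.+ ½ ℚ.* ε) ℚ.+ ½ ℚ.* ε      ≡⟨ ℚ.+-assoc (seq z n) _ _ ⟩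
    seq z n ℚ.+ (½ ℚ.* ε ℚ.+ ½ ℚ.* ε)      ≡⟨ cong (seq z n ℚ.+_) (halve ε) ⟩
    seq z n ℚ.+ ε                          ∎)
  (x≤y (½ ℚ.* ε) (0<½ε 0<ε)) (y≤z (½ ℚ.* ε) (0<½ε 0<ε))
  where open ℚ.≤-Reasoning

seq-≡⇒≈ : ∀ {x y} → (∀ n → seq x n ≡ seq y n) → x ≈ y
seq-≡⇒≈ {x} {y} eq ε 0<ε = 0 , λ n _ →
  subst (ℚ._< ε) (sym (cong ∣_∣ (trans (cong (ℚ._- seq y n) (eq n)) (ℚ.+-inverseʳ (seq y n))))) 0<ε

≈-isEquivalence : IsEquivalence _≈_
≈-isEquivalence = record
  { refl  = λ {x} → seq-≡⇒≈ {x} {x} (λ _ → refl)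
  ; sym   = λ {x} {y} → ≈-sym {x} {y}
  ; trans = λ {x} {y} {z} x≈y y≈z → ≤-antisym {x} {z}
      (≤-trans {x} {y} {z} (≈⇒≤ {x} {y} x≈y) (≈⇒≤ {y} {z} y≈z))
      (≤-trans {z} {y} {x} (≈⇒≤ {z} {y} (≈-sym {y} {z} y≈z)) (≈⇒≤ {y} {x} (≈-sym {x} {y} x≈y)))
  }

<⇒≱ : ∀ {x y} → x < y → ¬ (y ≤ x)
-- The gap `ε` of the strict inequality serves as the tolerance in `y ≤ x`: at late indices
-- `seq x n ℚ.+ ε` would be less than itself.
<⇒≱ (ε , 0<ε , x<y) y≤x with eventually-zip (λ _ → ℚ.<-trans) x<y (y≤x ε 0<ε)
... | N , h = ℚ.<-irrefl refl (h N ℕ.≤-refl)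

<⇒≤ : ∀ {x y} → x < y → x ≤ y
<⇒≤ {x} {y} (ε , 0<ε , x<y) δ 0<δ = eventually-map (λ n p → begin-strict
    seq x n            ≡⟨ ℚ.+-identityʳ (seq x n) ⟨
    seq x n ℚ.+ 0ℚ     <⟨ ℚ.+-monoʳ-< (seq x n) 0<ε ⟩
    seq x n ℚ.+ ε      <⟨ p ⟩
    seq y n            ≡⟨ ℚ.+-identityʳ (seq y n) ⟨
    seq y n ℚ.+ 0ℚ     <⟨ ℚ.+-monoʳ-< (seq y n) 0<δ ⟩
    seq y n ℚ.+ δ      ∎) x<y
  where open ℚ.≤-Reasoning

-- The order as a negation of the reversed strict order.

-- The two alternatives overlap, so they can be decided: one rational term `seq x N`, within `ε`/4
-- of all later terms, is compared with `ε`/2.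
eventually-<-or-pos : ∀ x ε → 0ℚ ℚ.< ε → Eventually (λ n → seq x n ℚ.< ε) ⊎ 0ℝ < x
eventually-<-or-pos x ε 0<ε with cauchy x (½ ℚ.* (½ ℚ.* ε)) (0<½ε (0<½ε 0<ε))
... | N , h with seq x N ℚ.<? ½ ℚ.* ε
... | yes xN<½ε = inj₁ (N , λ n N≤n → begin-strict
    seq x n                                      ≡⟨ shift (seq x n) (seq x N) ⟩
    (seq x n ℚ.- seq x N) ℚ.+ seq x N            <⟨ ℚ.+-mono-<
                                                      (ℚ.≤-<-trans (p≤∣p∣ (seq x n ℚ.- seq x N)) (h n N N≤n ℕ.≤-refl)) xN<½ε ⟩
    δ ℚ.+ ½ ℚ.* ε                                ≡⟨ cong (ℚ._+ ½ ℚ.* ε) (ℚ.+-identityʳ δ) ⟨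
    (δ ℚ.+ 0ℚ) ℚ.+ ½ ℚ.* ε                       <⟨ ℚ.+-monoˡ-< (½ ℚ.* ε) (ℚ.+-monoʳ-< δ 0<δ) ⟩
    (δ ℚ.+ δ) ℚ.+ ½ ℚ.* ε                        ≡⟨ cong (ℚ._+ ½ ℚ.* ε) (halve (½ ℚ.* ε)) ⟩
    ½ ℚ.* ε ℚ.+ ½ ℚ.* ε                          ≡⟨ halve ε ⟩
    ε                                            ∎)
  where
  open ℚ.≤-Reasoning
  δ : ℚ
  δ = ½ ℚ.* (½ ℚ.* ε)
  0<δ : 0ℚ ℚ.< δ
  0<δ = 0<½ε (0<½ε 0<ε)
-- The witness `δ` is `ε`/4: later terms exceed `seq x N ℚ.- δ`, which is at least `ε`/2 - `ε`/4.
... | no xN≮½ε = inj₂ (δ , 0<½ε (0<½ε 0<ε) , N , λ n N≤n → begin-strict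
    0ℚ ℚ.+ δ                                     ≡⟨ ℚ.+-identityˡ δ ⟩
    δ                                            ≡⟨ solve 1 (λ d → d := (d :+ d) :- d) refl δ ⟩
    (δ ℚ.+ δ) ℚ.- δ                              ≡⟨ cong (ℚ._- δ) (halve (½ ℚ.* ε)) ⟩
    ½ ℚ.* ε ℚ.- δ                                ≤⟨ ℚ.+-monoˡ-≤ (ℚ.- δ) (ℚ.≮⇒≥ xN≮½ε) ⟩
    seq x N ℚ.- δ                                <⟨ p<q+r⇒p-q<r (subst (seq x N ℚ.<_) (ℚ.+-comm (seq x n) δ)
                                                      (p-q<r⇒p<q+r (ℚ.≤-<-trans (p≤∣p∣ (seq x N ℚ.- seq x n)) (h N n ℕ.≤-refl N≤n)))) ⟩
    seq x n                                      ∎)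
  where
  open ℚ.≤-Reasoning
  δ : ℚ
  δ = ½ ℚ.* (½ ℚ.* ε)

const : ℚ → ℝ
const q = mkℝ (λ _ → q) (const-cauchy q)

infixl 6 _-_

-- Built from `_+_` and `_*_`, so that the Cauchy property comes with it.
_-_ : ℝ → ℝ → ℝ
x - y = x + const (ℚ.- 1ℚ) * y

seq-- : ∀ x y n → seq (x - y) n ≡ seq x n ℚ.- seq y n
seq-- x y n = cong (seq x n ℚ.+_) (trans
  (sym (ℚ.neg-distribˡ-* 1ℚ (seq y n)))
  (cong ℚ.-_ (ℚ.*-identityˡ (seq y n))))

-- For each tolerance, the dichotomy above applies to `x - y`; its positive alternative would give
-- `y < x`. No excluded middle enters.
≮⇒≥ : ∀ {x y} → ¬ (y < x) → x ≤ y
≮⇒≥ {x} {y} y≮x ε 0<ε = [ eventually-map x<y+ε , (λ 0<x-y → contradiction (y<x 0<x-y) y≮x) ]′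
  (eventually-<-or-pos (x - y) ε 0<ε)
  where
  open ℚ.≤-Reasoning

  x<y+ε : ∀ n → seq (x - y) n ℚ.< ε → seq x n ℚ.< seq y n ℚ.+ ε
  x<y+ε n p = p-q<r⇒p<q+r (subst (ℚ._< ε) (seq-- x y n) p)

  y<x : 0ℝ < x - y → y < x
  y<x (δ , 0<δ , δ<x-y) = δ , 0<δ , eventually-map (λ n p → begin-strict
    seq y n ℚ.+ δ                        ≡⟨ cong (seq y n ℚ.+_) (ℚ.+-identityˡ δ) ⟨
    seq y n ℚ.+ (0ℚ ℚ.+ δ)               <⟨ ℚ.+-monoʳ-< (seq y n) p ⟩
    seq y n ℚ.+ seq (x - y) n            ≡⟨ cong (seq y n ℚ.+_) (seq-- x y n) ⟩
    seq y n ℚ.+ (seq x n ℚ.- seq y n)    ≡⟨ ℚ.+-comm (seq y n) (seq x n ℚ.- seq y n) ⟩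
    (seq x n ℚ.- seq y n) ℚ.+ seq y n    ≡⟨ shift (seq x n) (seq y n) ⟨
    seq x n                              ∎) δ<x-y

-- Compatibility of addition and multiplication with equality and order.

≤-refl : ∀ {x} → x ≤ x
≤-refl {x} = ≈⇒≤ {x} {x} (IsEquivalence.refl ≈-isEquivalence {x})

+-mono-≤ : ∀ {x y z w} → x ≤ y → z ≤ w → x + z ≤ y + w
+-mono-≤ {x} {y} {z} {w} x≤y z≤w ε 0<ε = eventually-zip (λ n p q → begin-strict
    seq x n ℚ.+ seq z n                                    <⟨ ℚ.+-mono-< p q ⟩
    (seq y n ℚ.+ ½ ℚ.* ε) ℚ.+ (seq w n ℚ.+ ½ ℚ.* ε)        ≡⟨ solve 4 (λ a b c d → (a :+ b) :+ (c :+ d) := (a :+ c) :+ (b :+ d)) refl (seq y n) _ (seq w n) _ ⟩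
    (seq y n ℚ.+ seq w n) ℚ.+ (½ ℚ.* ε ℚ.+ ½ ℚ.* ε)        ≡⟨ cong ((seq y n ℚ.+ seq w n) ℚ.+_) (halve ε) ⟩
    (seq y n ℚ.+ seq w n) ℚ.+ ε                            ∎)
  (x≤y (½ ℚ.* ε) (0<½ε 0<ε)) (z≤w (½ ℚ.* ε) (0<½ε 0<ε))
  where open ℚ.≤-Reasoning

+-mono-<-≤ : ∀ {x y z w} → x < y → z ≤ w → x + z < y + w
-- Half of the gap `ε` pays for the slack in `z ≤ w`; the other half remains as the gap of the sums.
+-mono-<-≤ {x} {y} {z} {w} (ε , 0<ε , x<y) z≤w = ½ ℚ.* ε , 0<½ε 0<ε ,
  eventually-zip (λ n p q → begin-strict
    (seq x n ℚ.+ seq z n) ℚ.+ ½ ℚ.* ε                      ≡⟨ solve 3 (λ a c h → (a :+ c) :+ h := (a :+ (h :+ h)) :+ (c :- h)) refl (seq x n) (seq z n) (½ ℚ.* ε) ⟩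
    (seq x n ℚ.+ (½ ℚ.* ε ℚ.+ ½ ℚ.* ε)) ℚ.+ (seq z n ℚ.- ½ ℚ.* ε)
                                                           ≡⟨ cong (λ η → (seq x n ℚ.+ η) ℚ.+ (seq z n ℚ.- ½ ℚ.* ε)) (halve ε) ⟩
    (seq x n ℚ.+ ε) ℚ.+ (seq z n ℚ.- ½ ℚ.* ε)              <⟨ ℚ.+-mono-< p
                                                                (p<q+r⇒p-q<r (subst (seq z n ℚ.<_) (ℚ.+-comm (seq w n) _) q)) ⟩
    seq y n ℚ.+ seq w n                                    ∎)
  x<y (z≤w (½ ℚ.* ε) (0<½ε 0<ε))
  where open ℚ.≤-Reasoning

*-cong : ∀ {x x′ y y′} → x ≈ x′ → y ≈ y′ → x * y ≈ x′ * y′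
*-cong {x} {x′} {y} {y′} x≈x′ y≈y′ ε 0<ε =
  let A , 0<A , x≤A = bounded (cauchy x)
      B , 0<B , y′≤B = bounded (cauchy y′)
      -- The difference of the products is `x`(`y` - `y′`) + `y′`(`x` - `x′`). With `A` and `B`
      -- bounding `x` and `y′`, this choice of `δ` makes the total error less than `ε`.
      δ , 0<δ , [A+B]δ≡ε = divide (A ℚ.+ B) {{positive (ℚ.+-mono-< 0<A 0<B)}} 0<ε
      open ℚ.≤-Reasoning
  in eventually-zip (λ n (x≤A , y-y′<δ) (y′≤B , x-x′<δ) → begin-strict
      ∣ seq x n ℚ.* seq y n ℚ.- seq x′ n ℚ.* seq y′ n ∣
        ≡⟨ cong ∣_∣ (*-diff (seq x n) (seq y n) (seq x′ n) (seq y′ n)) ⟩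
      ∣ seq x n ℚ.* (seq y n ℚ.- seq y′ n) ℚ.+ seq y′ n ℚ.* (seq x n ℚ.- seq x′ n) ∣
        ≤⟨ ℚ.∣p+q∣≤∣p∣+∣q∣ (seq x n ℚ.* (seq y n ℚ.- seq y′ n)) (seq y′ n ℚ.* (seq x n ℚ.- seq x′ n)) ⟩
      ∣ seq x n ℚ.* (seq y n ℚ.- seq y′ n) ∣ ℚ.+ ∣ seq y′ n ℚ.* (seq x n ℚ.- seq x′ n) ∣
        <⟨ ℚ.+-mono-<
             (*-bound (seq x n) (seq y n ℚ.- seq y′ n) x≤A 0<A y-y′<δ)
             (*-bound (seq y′ n) (seq x n ℚ.- seq x′ n) y′≤B 0<B x-x′<δ) ⟩
      A ℚ.* δ ℚ.+ B ℚ.* δ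
        ≡⟨ ℚ.*-distribʳ-+ δ A B ⟨
      (A ℚ.+ B) ℚ.* δ
        ≡⟨ [A+B]δ≡ε ⟩
      ε ∎)
    (eventually-zip (λ _ → _,_) x≤A (y≈y′ δ 0<δ))
    (eventually-zip (λ _ → _,_) y′≤B (x≈x′ δ 0<δ))

+-cong : ∀ {x x′ y y′} → x ≈ x′ → y ≈ y′ → x + y ≈ x′ + y′
+-cong {x} {x′} {y} {y′} x≈x′ y≈y′ = ≤-antisym {x + y} {x′ + y′}
  (+-mono-≤ {x} {x′} {y} {y′} (≈⇒≤ {x} {x′} x≈x′) (≈⇒≤ {y} {y′} y≈y′))
  (+-mono-≤ {x′} {x} {y′} {y} (≈⇒≤ {x′} {x} (≈-sym {x} {x′} x≈x′)) (≈⇒≤ {y′} {y} (≈-sym {y} {y′} y≈y′)))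

≤-respects-≈ : ∀ {x x′ y y′} → x ≈ x′ → y ≈ y′ → x ≤ y → x′ ≤ y′
≤-respects-≈ {x} {x′} {y} {y′} x≈x′ y≈y′ x≤y =
  ≤-trans {x′} {x} {y′} (≈⇒≤ {x′} {x} (≈-sym {x} {x′} x≈x′))
    (≤-trans {x} {y} {y′} x≤y (≈⇒≤ {y} {y′} y≈y′))

-- Each of the two inequalities is a negation, and from a double negation one may always conclude a
-- negation.
≈-stable : ∀ {x y} → ¬ ¬ (x ≈ y) → x ≈ y
≈-stable {x} {y} ¬¬x≈y = ≤-antisym {x} {y}
  (≮⇒≥ {x} {y} (λ y<x → ¬¬x≈y (λ x≈y → <⇒≱ {y} {x} y<x (≈⇒≤ {x} {y} x≈y))))
  (≮⇒≥ {y} {x} (λ x<y → ¬¬x≈y (λ x≈y → <⇒≱ {x} {y} x<y (≈⇒≤ {y} {x} (≈-sym {x} {y} x≈y)))))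

*-monoʳ-<-pos : ∀ {s x y} → 0ℝ < s → x < y → s * x < s * y
*-monoʳ-<-pos {s} {x} {y} (δ , 0<δ , δ<s) (ε , 0<ε , x<y) =
  -- `s` stays above `δ` and `y` exceeds `x` by `ε`, so the product of the two gaps is a gap for the
  -- products.
  δ ℚ.* ε , subst (ℚ._< δ ℚ.* ε) (ℚ.*-zeroʳ δ) (ℚ.*-monoʳ-<-pos δ {{positive 0<δ}} 0<ε) ,
  eventually-zip (λ n p q →
    let δ<sₙ = subst (ℚ._< seq s n) (ℚ.+-identityˡ δ) p in begin-strict
    seq s n ℚ.* seq x n ℚ.+ δ ℚ.* ε              <⟨ ℚ.+-monoʳ-< (seq s n ℚ.* seq x n) (ℚ.*-monoˡ-<-pos ε {{positive 0<ε}} δ<sₙ) ⟩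
    seq s n ℚ.* seq x n ℚ.+ seq s n ℚ.* ε        ≡⟨ ℚ.*-distribˡ-+ (seq s n) (seq x n) ε ⟨
    seq s n ℚ.* (seq x n ℚ.+ ε)                  <⟨ ℚ.*-monoʳ-<-pos (seq s n) {{positive (ℚ.<-trans 0<δ δ<sₙ)}} q ⟩
    seq s n ℚ.* seq y n                          ∎)
  δ<s x<y
  where open ℚ.≤-Reasoning

*-monoʳ-≤-pos : ∀ {s x y} → 0ℝ < s → x ≤ y → s * x ≤ s * y
*-monoʳ-≤-pos {s} {x} {y} (δ , 0<δ , δ<s) x≤y ε 0<ε =
  let B , 0<B , s≤B = bounded (cauchy s)
      η , 0<η , Bη≡ε = divide B {{positive 0<B}} 0<ε
      open ℚ.≤-Reasoning
  in eventually-zip (λ n (p , s≤B) q →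
    let 0<sₙ = ℚ.<-trans 0<δ (subst (ℚ._< seq s n) (ℚ.+-identityˡ δ) p) in begin-strict
    seq s n ℚ.* seq x n                          <⟨ ℚ.*-monoʳ-<-pos (seq s n) {{positive 0<sₙ}} q ⟩
    seq s n ℚ.* (seq y n ℚ.+ η)                  ≡⟨ ℚ.*-distribˡ-+ (seq s n) (seq y n) η ⟩
    seq s n ℚ.* seq y n ℚ.+ seq s n ℚ.* η        ≤⟨ ℚ.+-monoʳ-≤ (seq s n ℚ.* seq y n)
                                                      (ℚ.*-monoʳ-≤-nonNeg η {{ℚ.nonNegative (ℚ.<⇒≤ 0<η)}}
                                                        (ℚ.≤-trans (p≤∣p∣ (seq s n)) s≤B)) ⟩
    seq s n ℚ.* seq y n ℚ.+ B ℚ.* η              ≡⟨ cong (seq s n ℚ.* seq y n ℚ.+_) Bη≡ε ⟩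
    seq s n ℚ.* seq y n ℚ.+ ε                    ∎)
    (eventually-zip (λ _ → _,_) δ<s s≤B) (x≤y η 0<η)

-- The condition is `¬ (s ≤ 0ℝ)` because this follows from `0ℝ ≤ s` and `¬ (s ≈ 0ℝ)`, whereas
-- `0ℝ < s` would require Markov's principle. It suffices since the conclusion is itself a negation.
*-cancelˡ-≤ : ∀ {s x y} → ¬ (s ≤ 0ℝ) → s * x ≤ s * y → x ≤ y
*-cancelˡ-≤ {s} {x} {y} s≰0 sx≤sy = ≮⇒≥ {x} {y} λ y<x → s≰0 (≮⇒≥ {s} {0ℝ} λ 0<s →
  <⇒≱ {s * y} {s * x} (*-monoʳ-<-pos {s} {y} {x} 0<s y<x) sx≤sy)

*-cancelˡ-≈ : ∀ {s x y} → ¬ (s ≤ 0ℝ) → s * x ≈ s * y → x ≈ y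
*-cancelˡ-≈ {s} {x} {y} s≰0 sx≈sy = ≤-antisym {x} {y}
  (*-cancelˡ-≤ {s} {x} {y} s≰0 (≈⇒≤ {s * x} {s * y} sx≈sy))
  (*-cancelˡ-≤ {s} {y} {x} s≰0 (≈⇒≤ {s * y} {s * x} (≈-sym {s * x} {s * y} sx≈sy)))

-- The commutative semiring of real numbers.

-- The algebraic laws hold term by term for the rational sequences; only equivalence and congruence
-- rest on estimates. The bundle gives access to the general lemmas on finite sums.
+-*-commutativeSemiring : CommutativeSemiring 0ℓ 0ℓ
+-*-commutativeSemiring = record
  { _+_ = _+_
  ; _*_ = _*_
  ; 0# = 0ℝ
  ; 1# = const 1ℚ
  ; isCommutativeSemiring = IsCommutativeSemiringˡ.isCommutativeSemiring record
    { +-isCommutativeMonoid = record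
      { isMonoid = record
        { isSemigroup = record
          { isMagma = record
            { isEquivalence = ≈-isEquivalence
            ; ∙-cong = λ {x} {x′} {y} {y′} → +-cong {x} {x′} {y} {y′} }
          ; assoc = λ x y z → seq-≡⇒≈ {(x + y) + z} {x + (y + z)} λ n → ℚ.+-assoc (seq x n) (seq y n) (seq z n) }
        ; identity = (λ x → seq-≡⇒≈ {0ℝ + x} {x} λ n → ℚ.+-identityˡ (seq x n))
                   , (λ x → seq-≡⇒≈ {x + 0ℝ} {x} λ n → ℚ.+-identityʳ (seq x n)) }
      ; comm = λ x y → seq-≡⇒≈ {x + y} {y + x} λ n → ℚ.+-comm (seq x n) (seq y n) }
    ; *-isCommutativeMonoid = record
      { isMonoid = record
        { isSemigroup = record
          { isMagma = record
            { isEquivalence = ≈-isEquivalence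
            ; ∙-cong = λ {x} {x′} {y} {y′} → *-cong {x} {x′} {y} {y′} }
          ; assoc = λ x y z → seq-≡⇒≈ {(x * y) * z} {x * (y * z)} λ n → ℚ.*-assoc (seq x n) (seq y n) (seq z n) }
        ; identity = (λ x → seq-≡⇒≈ {const 1ℚ * x} {x} λ n → ℚ.*-identityˡ (seq x n))
                   , (λ x → seq-≡⇒≈ {x * const 1ℚ} {x} λ n → ℚ.*-identityʳ (seq x n)) }
      ; comm = λ x y → seq-≡⇒≈ {x * y} {y * x} λ n → ℚ.*-comm (seq x n) (seq y n) }
    ; distribʳ = λ x y z → seq-≡⇒≈ {(y + z) * x} {y * x + z * x} λ n → ℚ.*-distribʳ-+ (seq x n) (seq y n) (seq z n)
    ; zeroˡ = λ x → seq-≡⇒≈ {0ℝ * x} {0ℝ} λ n → ℚ.*-zeroˡ (seq x n)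
    }
  }

open CommutativeSemiring +-*-commutativeSemiring
  using (semiring; setoid; +-comm; *-assoc; *-comm; zeroˡ)
  renaming (refl to ≈-refl; trans to ≈-trans)
module ∑ = SemiringSum semiring

*-congˡ : ∀ s {x y} → x ≈ y → s * x ≈ s * y
*-congˡ s {x} {y} = *-cong {s} {s} {x} {y} (≈-refl {s})

*-congʳ : ∀ s {x y} → x ≈ y → x * s ≈ y * s
*-congʳ s {x} {y} x≈y = *-cong {x} {y} {s} {s} x≈y (≈-refl {s})

-- Nonnegative factors and the case of a zero factor.

nonNeg-≉0⇒≰0 : ∀ {s} → 0ℝ ≤ s → ¬ (s ≈ 0ℝ) → ¬ (s ≤ 0ℝ)
nonNeg-≉0⇒≰0 {s} 0≤s s≉0 s≤0 = s≉0 (≤-antisym {s} {0ℝ} s≤0 0≤s)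

*-cong-zero : ∀ {s} x y → s ≈ 0ℝ → s * x ≈ s * y
*-cong-zero {s} x y s≈0 = begin
  s * x      ≈⟨ *-congʳ x {s} {0ℝ} s≈0 ⟩
  0ℝ * x     ≈⟨ zeroˡ x ⟩
  0ℝ         ≈⟨ zeroˡ y ⟨
  0ℝ * y     ≈⟨ *-congʳ y {s} {0ℝ} s≈0 ⟨
  s * y      ∎
  where open SetoidReasoning setoid

-- If the products differed, `s` could not be zero, so the hypothesis would make them equal after
-- all; stability of `_≈_` then removes the double negation.
*-cong-≉0 : ∀ {s x y} → (¬ (s ≈ 0ℝ) → x ≈ y) → s * x ≈ s * y
*-cong-≉0 {s} {x} {y} x≈y = ≈-stable {s * x} {s * y} λ sx≉sy →
  sx≉sy (*-congˡ s {x} {y} (x≈y (sx≉sy ∘ *-cong-zero {s} x y)))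

-- Were `s * y < s * x`, then `s` could be neither zero nor positive, contradicting `0ℝ ≤ s`.
*-monoʳ-≤-nonNeg : ∀ {s x y} → 0ℝ ≤ s → x ≤ y → s * x ≤ s * y
*-monoʳ-≤-nonNeg {s} {x} {y} 0≤s x≤y = ≮⇒≥ {s * x} {s * y} λ sy<sx →
  nonNeg-≉0⇒≰0 {s} 0≤s
    (λ s≈0 → <⇒≱ {s * y} {s * x} sy<sx (≈⇒≤ {s * x} {s * y} (*-cong-zero {s} x y s≈0)))
    (≮⇒≥ {s} {0ℝ} λ 0<s → <⇒≱ {s * y} {s * x} sy<sx (*-monoʳ-≤-pos {s} {x} {y} 0<s x≤y))

-- Inequalities between finite sums.

sum-mono-≤ : ∀ {n} (a b : Vector ℝ n) → (∀ i → a i ≤ b i) → sum a ≤ sum b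
sum-mono-≤ {zero}  a b a≤b = ≤-refl {0ℝ}
sum-mono-≤ {suc n} a b a≤b = +-mono-≤ {a zero} {b zero} {sum (a ∘ suc)} {sum (b ∘ suc)}
  (a≤b zero) (sum-mono-≤ (a ∘ suc) (b ∘ suc) (a≤b ∘ suc))

-- A strict inequality `x < y` would make the sums strictly ordered.
+-cancel-≤-≈ : ∀ {x y z w} → x ≤ y → z ≤ w → x + z ≈ y + w → x ≈ y
+-cancel-≤-≈ {x} {y} {z} {w} x≤y z≤w x+z≈y+w = ≤-antisym {x} {y} x≤y
  (≮⇒≥ {y} {x} λ x<y → <⇒≱ {x + z} {y + w} (+-mono-<-≤ {x} {y} {z} {w} x<y z≤w)
    (≈⇒≤ {y + w} {x + z} (≈-sym {x + z} {y + w} x+z≈y+w)))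

sum-≈⇒≈ : ∀ {n} (a b : Vector ℝ n) → (∀ i → a i ≤ b i) → sum a ≈ sum b → ∀ i → a i ≈ b i
sum-≈⇒≈ a b a≤b ∑a≈∑b zero = +-cancel-≤-≈ {a zero} {b zero} {sum (a ∘ suc)} {sum (b ∘ suc)}
  (a≤b zero) (sum-mono-≤ (a ∘ suc) (b ∘ suc) (a≤b ∘ suc)) ∑a≈∑b
sum-≈⇒≈ a b a≤b ∑a≈∑b (suc i) = sum-≈⇒≈ (a ∘ suc) (b ∘ suc) (a≤b ∘ suc)
  -- Commuting the summands puts the tails in the cancelled position, so the tail sums agree and the
  -- recursion applies to them.
  (+-cancel-≤-≈ {sum (a ∘ suc)} {sum (b ∘ suc)} {a zero} {b zero}
    (sum-mono-≤ (a ∘ suc) (b ∘ suc) (a≤b ∘ suc)) (a≤b zero) (begin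
      sum (a ∘ suc) + a zero      ≈⟨ +-comm (sum (a ∘ suc)) (a zero) ⟩
      sum a                       ≈⟨ ∑a≈∑b ⟩
      sum b                       ≈⟨ +-comm (b zero) (sum (b ∘ suc)) ⟩
      sum (b ∘ suc) + b zero      ∎)) i
  where open SetoidReasoning setoid

-- Dot products and matrix action.

sum-cong : ∀ {n} (a b : Vector ℝ n) → (∀ i → a i ≈ b i) → sum a ≈ sum b
sum-cong a b = ∑.sum-cong-≋ {_} {a} {b}

*-distribˡ-sum : ∀ {n} x (a : Vector ℝ n) → x * sum a ≈ sum (λ i → x * a i)
*-distribˡ-sum = ∑.*-distribˡ-sum

*-distribʳ-sum : ∀ {n} x (a : Vector ℝ n) → sum a * x ≈ sum (λ i → a i * x)
*-distribʳ-sum = ∑.*-distribʳ-sum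

sum-comm : ∀ {m n} (f : Fin m → Fin n → ℝ) →
  sum (λ i → sum (λ j → f i j)) ≈ sum (λ j → sum (λ i → f i j))
sum-comm = ∑.∑-comm

·-cong : ∀ {n} (a x y : Vector ℝ n) → (∀ i → x i ≈ y i) → a · x ≈ a · y
·-cong a x y x≈y = sum-cong (λ i → a i * x i) (λ i → a i * y i)
  (λ i → *-congˡ (a i) {x i} {y i} (x≈y i))

·-comm : ∀ {n} (a x : Vector ℝ n) → a · x ≈ x · a
·-comm a x = sum-cong (λ i → a i * x i) (λ i → x i * a i) (λ i → *-comm (a i) (x i))

*-·-assoc : ∀ {n} μ (a x : Vector ℝ n) → (λ i → μ * a i) · x ≈ μ * (a · x)
*-·-assoc μ a x = begin
  sum (λ i → μ * a i * x i)          ≈⟨ sum-cong (λ i → μ * a i * x i) (λ i → μ * (a i * x i)) (λ i → *-assoc μ (a i) (x i)) ⟩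
  sum (λ i → μ * (a i * x i))        ≈⟨ *-distribˡ-sum μ (λ i → a i * x i) ⟨
  μ * sum (λ i → a i * x i)          ∎
  where open SetoidReasoning setoid

-- Both sides are the same double sum, taken in the two orders.
·-∗ᵥ : ∀ {n} (a : Vector ℝ n) (M : Matrix n) (x : Vector ℝ n) → (a ᵥ∗ M) · x ≈ a · (M ∗ᵥ x)
·-∗ᵥ a M x = begin
  sum (λ j → (a ᵥ∗ M) j * x j)                   ≈⟨ sum-cong (λ j → (a ᵥ∗ M) j * x j) (λ j → sum (λ i → a i * M i j * x j))
                                                      (λ j → *-distribʳ-sum (x j) (λ i → a i * M i j)) ⟩
  sum (λ j → sum (λ i → a i * M i j * x j))      ≈⟨ sum-comm (λ j i → a i * M i j * x j) ⟩
  sum (λ i → sum (λ j → a i * M i j * x j))      ≈⟨ sum-cong (λ i → sum (λ j → a i * M i j * x j)) (λ i → a i * (M ∗ᵥ x) i)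
                                                      (λ i → *-·-assoc (a i) (M i) x) ⟩
  sum (λ i → a i * (M ∗ᵥ x) i)                   ∎
  where open SetoidReasoning setoid

-- The first step holds by refl, but comparing the two sums directly makes Agda
-- unfold the Cauchy proofs inside the products, which does not finish in practice.
∗-∗ᵥ : ∀ {n} (A B : Matrix n) (x : Vector ℝ n) i → ((A ∗ B) ∗ᵥ x) i ≈ (A ∗ᵥ (B ∗ᵥ x)) i
∗-∗ᵥ A B x i = begin
  sum (λ j → (A ∗ B) i j * x j)          ≈⟨ sum-cong (λ j → (A ∗ B) i j * x j) (λ j → (A i ᵥ∗ B) j * x j)
                                              (λ j → *-congʳ (x j) {(A ∗ B) i j} {(A i ᵥ∗ B) j} (≈-refl {(A ∗ B) i j})) ⟩
  (A i ᵥ∗ B) · x                         ≈⟨ ·-∗ᵥ (A i) B x ⟩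
  A i · (B ∗ᵥ x)                         ∎
  where open SetoidReasoning setoid

-- Absorbing `P` into `v` and `Q` into `u` turns the form of the product matrix into the form of `C`
-- at the vectors that the eigenvector hypotheses concern.
·-∗∗-∗ᵥ : ∀ {n} (v : Vector ℝ n) (P C Q : Matrix n) (u : Vector ℝ n) →
  v · ((P ∗ C ∗ Q) ∗ᵥ u) ≈ (v ᵥ∗ P) · (C ∗ᵥ (Q ∗ᵥ u))
·-∗∗-∗ᵥ v P C Q u = begin
  v · ((P ∗ C ∗ Q) ∗ᵥ u)             ≈⟨ ·-cong v ((P ∗ C ∗ Q) ∗ᵥ u) ((P ∗ C) ∗ᵥ (Q ∗ᵥ u)) (∗-∗ᵥ (P ∗ C) Q u) ⟩
  v · ((P ∗ C) ∗ᵥ (Q ∗ᵥ u))          ≈⟨ ·-cong v ((P ∗ C) ∗ᵥ (Q ∗ᵥ u)) (P ∗ᵥ (C ∗ᵥ (Q ∗ᵥ u))) (∗-∗ᵥ P C (Q ∗ᵥ u)) ⟩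
  v · (P ∗ᵥ (C ∗ᵥ (Q ∗ᵥ u)))         ≈⟨ ·-∗ᵥ v P (C ∗ᵥ (Q ∗ᵥ u)) ⟨
  (v ᵥ∗ P) · (C ∗ᵥ (Q ∗ᵥ u))         ∎
  where open SetoidReasoning setoid

-- The scalar `w · x` is put on the left, ready for cancellation from `s * μ` and `s * μ′`.
leftEigen-· : ∀ {n} (C : Matrix n) μ (w x : Vector ℝ n) →
  (∀ j → (w ᵥ∗ C) j ≈ μ * w j) → w · (C ∗ᵥ x) ≈ (w · x) * μ
leftEigen-· C μ w x wC≈μw = begin
  w · (C ∗ᵥ x)                 ≈⟨ ·-∗ᵥ w C x ⟨
  (w ᵥ∗ C) · x                 ≈⟨ ·-comm (w ᵥ∗ C) x ⟩
  x · (w ᵥ∗ C)                 ≈⟨ ·-cong x (w ᵥ∗ C) (λ j → μ * w j) wC≈μw ⟩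
  x · (λ j → μ * w j)          ≈⟨ ·-comm x (λ j → μ * w j) ⟩
  (λ j → μ * w j) · x          ≈⟨ *-·-assoc μ w x ⟩
  μ * (w · x)                  ≈⟨ *-comm μ (w · x) ⟩
  (w · x) * μ                  ∎
  where open SetoidReasoning setoid

rightEigen-· : ∀ {n} (C : Matrix n) μ (w x : Vector ℝ n) →
  (∀ i → (C ∗ᵥ x) i ≈ μ * x i) → w · (C ∗ᵥ x) ≈ (w · x) * μ
rightEigen-· C μ w x Cx≈μx = begin
  w · (C ∗ᵥ x)                 ≈⟨ ·-cong w (C ∗ᵥ x) (λ i → μ * x i) Cx≈μx ⟩
  w · (λ i → μ * x i)          ≈⟨ ·-comm w (λ i → μ * x i) ⟩
  (λ i → μ * x i) · w          ≈⟨ *-·-assoc μ x w ⟩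
  μ * (x · w)                  ≈⟨ *-comm μ (x · w) ⟩
  (x · w) * μ                  ≈⟨ *-congʳ μ {x · w} {w · x} (·-comm x w) ⟩
  (w · x) * μ                  ∎
  where open SetoidReasoning setoid

-- Comparison of weighted sums and the equality case.

·-monoʳ-≤ : ∀ {n} (a : Vector ℝ n) → NonNegative a → (x y : Vector ℝ n) →
  (∀ i → x i ≤ y i) → a · x ≤ a · y
·-monoʳ-≤ a 0≤a x y x≤y = sum-mono-≤ (λ i → a i * x i) (λ i → a i * y i)
  (λ i → *-monoʳ-≤-nonNeg {a i} {x i} {y i} (0≤a i) (x≤y i))

-- The terms are ordered and their sums agree, so the terms agree one by one; a nonnegative nonzero
-- weight then cancels.
·-cancelˡ-≈ : ∀ {n} (a : Vector ℝ n) → NonNegative a → (x y : Vector ℝ n) →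
  (∀ i → x i ≤ y i) → a · x ≈ a · y → ∀ i → ¬ (a i ≈ 0ℝ) → x i ≈ y i
·-cancelˡ-≈ a 0≤a x y x≤y ax≈ay i aᵢ≉0 =
  *-cancelˡ-≈ {a i} {x i} {y i} (nonNeg-≉0⇒≰0 {a i} (0≤a i) aᵢ≉0)
    (sum-≈⇒≈ (λ i → a i * x i) (λ i → a i * y i)
      (λ i → *-monoʳ-≤-nonNeg {a i} {x i} {y i} (0≤a i) (x≤y i)) ax≈ay i)

·-cong-≉0 : ∀ {n} (a x y : Vector ℝ n) → (∀ i → ¬ (a i ≈ 0ℝ) → x i ≈ y i) → a · x ≈ a · y
·-cong-≉0 a x y x≈y = sum-cong (λ i → a i * x i) (λ i → a i * y i)
  (λ i → *-cong-≉0 {a i} {x i} {y i} (x≈y i))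

-- This isolates the order argument: the eigenvectors enter only through the values `s * μ` and
-- `s * μ′` of the two bilinear forms.
bilinear-comparison : ∀ {n} (M M′ : Matrix n) (u v : Vector ℝ n) (s μ μ′ : ℝ) →
  (∀ i j → M i j ≤ M′ i j) → NonNegative u → NonNegative v → ¬ (s ≤ 0ℝ) →
  v · (M ∗ᵥ u) ≈ s * μ → v · (M′ ∗ᵥ u) ≈ s * μ′ →
  (μ ≤ μ′) ×
  ((μ ≈ μ′) ⇔ (∀ i j → ¬ (v i ≈ 0ℝ) → ¬ (u j ≈ 0ℝ) → M′ i j ≈ M i j))
bilinear-comparison M M′ u v s μ μ′ M≤M′ 0≤u 0≤v s≰0 vMu≈sμ vM′u≈sμ′ =
  *-cancelˡ-≤ {s} {μ} {μ′} s≰0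
    (≤-respects-≈ {v · (M ∗ᵥ u)} {s * μ} {v · (M′ ∗ᵥ u)} {s * μ′} vMu≈sμ vM′u≈sμ′
      (·-monoʳ-≤ v 0≤v (M ∗ᵥ u) (M′ ∗ᵥ u) Mu≤M′u)) ,
  mk⇔ μ≈μ′⇒M′≈M M′≈M⇒μ≈μ′
  where
  open SetoidReasoning setoid

  Mu≤M′u : ∀ i → (M ∗ᵥ u) i ≤ (M′ ∗ᵥ u) i
  Mu≤M′u i = ≤-respects-≈ {u · M i} {(M ∗ᵥ u) i} {u · M′ i} {(M′ ∗ᵥ u) i}
    (·-comm u (M i)) (·-comm u (M′ i))
    (·-monoʳ-≤ u 0≤u (M i) (M′ i) (M≤M′ i))

  μ≈μ′⇒M′≈M : μ ≈ μ′ → ∀ i j → ¬ (v i ≈ 0ℝ) → ¬ (u j ≈ 0ℝ) → M′ i j ≈ M i j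
  μ≈μ′⇒M′≈M μ≈μ′ i j vᵢ≉0 uⱼ≉0 = ≈-sym {M i j} {M′ i j}
    -- The equality case is used twice: with weights `v` it equates the entries of `M ∗ᵥ u` and
    -- `M′ ∗ᵥ u` at `i`, then with weights `u` the matrix entries of row `i`.
    (·-cancelˡ-≈ u 0≤u (M i) (M′ i) (M≤M′ i) (begin
      u · M i            ≈⟨ ·-comm u (M i) ⟩
      (M ∗ᵥ u) i         ≈⟨ ·-cancelˡ-≈ v 0≤v (M ∗ᵥ u) (M′ ∗ᵥ u) Mu≤M′u vMu≈vM′u i vᵢ≉0 ⟩
      (M′ ∗ᵥ u) i        ≈⟨ ·-comm (M′ i) u ⟩
      u · M′ i           ∎) j uⱼ≉0)
    where
    vMu≈vM′u : v · (M ∗ᵥ u) ≈ v · (M′ ∗ᵥ u)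
    vMu≈vM′u = begin
      v · (M ∗ᵥ u)       ≈⟨ vMu≈sμ ⟩
      s * μ              ≈⟨ *-congˡ s {μ} {μ′} μ≈μ′ ⟩
      s * μ′             ≈⟨ vM′u≈sμ′ ⟨
      v · (M′ ∗ᵥ u)      ∎

  M′≈M⇒μ≈μ′ : (∀ i j → ¬ (v i ≈ 0ℝ) → ¬ (u j ≈ 0ℝ) → M′ i j ≈ M i j) → μ ≈ μ′
  M′≈M⇒μ≈μ′ M′≈M = *-cancelˡ-≈ {s} {μ} {μ′} s≰0 (begin
    s * μ              ≈⟨ vMu≈sμ ⟨
    -- Rows with zero weight in `v`, and within a row entries with zero weight in `u`, contribute
    -- equally to both forms, so agreement on the supports is enough.
    v · (M ∗ᵥ u)       ≈⟨ ·-cong-≉0 v (M′ ∗ᵥ u) (M ∗ᵥ u) (λ i vᵢ≉0 → begin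
                            (M′ ∗ᵥ u) i      ≈⟨ ·-comm (M′ i) u ⟩
                            u · M′ i         ≈⟨ ·-cong-≉0 u (M′ i) (M i) (λ j → M′≈M i j vᵢ≉0) ⟩
                            u · M i          ≈⟨ ·-comm u (M i) ⟩
                            (M ∗ᵥ u) i       ∎) ⟨
    v · (M′ ∗ᵥ u)      ≈⟨ vM′u≈sμ′ ⟩
    s * μ′             ∎)

lemma3p1 : ∀ (n : ℕ) (C C′ P Q : Matrix n) (u v : Vector ℝ n) (μ μ′ : ℝ) →
    (∀ i j → (P ∗ C ∗ Q) i j ≤ (P ∗ C′ ∗ Q) i j) →
    NonNegative u → IsEigenvector C′ μ′ (Q ∗ᵥ u) →
    NonNegative v → IsLeftEigenvector C μ (v ᵥ∗ P) →
    0ℝ < (v ᵥ∗ P) · (Q ∗ᵥ u) →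
    (μ ≤ μ′) ×
    ((μ ≈ μ′) ⇔
    (∀ i j → ¬ (v i ≈ 0ℝ) → ¬ (u j ≈ 0ℝ) →
    (P ∗ C′ ∗ Q) i j ≈ (P ∗ C ∗ Q) i j))
lemma3p1 n C C′ P Q u v μ μ′ M≤M′ 0≤u (_ , C′x≈μ′x) 0≤v (_ , wC≈μw) 0<s =
  bilinear-comparison (P ∗ C ∗ Q) (P ∗ C′ ∗ Q) u v ((v ᵥ∗ P) · (Q ∗ᵥ u)) μ μ′ M≤M′ 0≤u 0≤v
    (<⇒≱ {0ℝ} {(v ᵥ∗ P) · (Q ∗ᵥ u)} 0<s)
    -- The left eigenvector evaluates the form of `C`, and the right eigenvector that of `C′`, with
    -- the same scalar factor in both.
    (≈-trans {v · ((P ∗ C ∗ Q) ∗ᵥ u)} {(v ᵥ∗ P) · (C ∗ᵥ (Q ∗ᵥ u))} {((v ᵥ∗ P) · (Q ∗ᵥ u)) * μ}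
      (·-∗∗-∗ᵥ v P C Q u) (leftEigen-· C μ (v ᵥ∗ P) (Q ∗ᵥ u) wC≈μw))
    (≈-trans {v · ((P ∗ C′ ∗ Q) ∗ᵥ u)} {(v ᵥ∗ P) · (C′ ∗ᵥ (Q ∗ᵥ u))} {((v ᵥ∗ P) · (Q ∗ᵥ u)) * μ′}
      (·-∗∗-∗ᵥ v P C′ Q u) (rightEigen-· C′ μ′ (v ᵥ∗ P) (Q ∗ᵥ u) C′x≈μ′x))
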